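{- Let $G$ be a graph with vertex set $V$, and let $\mathcal{G}$ be the family of minimal generating sets of $G$. If $\mathcal{G}=\{L\}$ for a single set $L\subseteq V$, then $\operatorname{nim}(\mathrm{TER}(G))=1+\operatorname{pty}(L^c)$, where $L^c=V\setminus L$.
   Context: Graphs are finite and simple with nonempty vertex set. A set $K\subseteq V$ of vertices is convex if it contains every vertex lying on any shortest path between two elements of $K$. The convex hull $[P]$ of $P\subseteq V$ is the smallest convex set containing $P$. A set $P\subseteq V$ is generating if $[P]=V$; a minimal generating set is a generating set that is minimal under inclusion. For a finite set $A$, $\operatorname{pty}(A):=|A| \bmod 2\in\{0,1\}$. The game $\mathrm{TER}(G)$ (terminate): positions are the sets $P\subseteq V$ of jointly selected vertices reachable from the starting position $\emptyset$ by the following moves. If $[V\setminus P]=V$, then the options of $P$ are all sets $P\cup\{v\}$ with $v\in V\setminus P$; if $[V\setminus P]\neq V$, then $P$ is terminal (has no options). The nim-value of a position is defined recursively by $\operatorname{nim}(p)=\operatorname{mex}\{\operatorname{nim}(q): q\text{ an option of }p\}$, where $\operatorname{mex}(A)$ is the smallest nonnegative integer not in $A$; the nim-value of a game is that of its starting position. -}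

module Defs where

open import Data.Bool using (if_then_else_)
import Data.Bool.Properties as Bool
open import Data.Fin using (Fin; zero; suc)
import Data.Fin.Properties as Fin
open import Data.Fin.Subset
open import Data.Fin.Subset.Induction using (⊃-wellFounded)
open import Data.Fin.Subset.Properties
  using (_∈?_; _⊆?_; anySubset?; p⊆p∪q; q⊆p∪q; x∈⁅x⁆; x∈∁p⇒x∉p)
open import Data.List using (List; []; _∷_; allFin; filter; head; last; length; lookup; map)
open import Data.List.Extrema.Nat using (max; xs≤max)
import Data.List.Membership.DecPropositional as DecMembership
open import Data.List.Membership.Propositional using (mapWith∈)
  renaming (_∈_ to _∈ˡ_; _∉_ to _∉ˡ_)
open import Data.List.Membership.Propositional.Properties using (∈-filter⁻; ∈-lookup; ∈-map⁻)
open import Data.List.Relation.Unary.All as All using (All)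
open import Data.List.Relation.Unary.AllPairs using (_∷_)
open import Data.List.Relation.Unary.Linked using (Linked; linked?)
open import Data.List.Relation.Unary.Unique.Propositional using (Unique)
import Data.List.Relation.Unary.Unique.DecPropositional as DecUnique
open import Data.Maybe using (just)
import Data.Maybe.Properties as Maybe
open import Data.Nat using (ℕ; zero; suc; _+_; _≤_; _<_; _≤?_; _%_; NonZero; z≤n; s≤s)
import Data.Nat.Properties as ℕ
open import Data.Product using (∃; _×_; _,_; proj₁; proj₂)
open import Data.Sum using (inj₁; inj₂)
open import Data.Vec as Vec using (tabulate)
import Data.Vec.Properties as Vec
open import Function using (_∘_)
open import Induction.WellFounded using (Acc; acc; WellFounded; module Subrelation)
open import Level using (0ℓ)
open import Relation.Binary using (Rel; Symmetric; Irreflexive)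
import Relation.Binary as B
open import Relation.Binary.PropositionalEquality using (_≡_; refl; sym; trans; cong; subst)
open import Relation.Nullary using (Dec; yes; no; does; ¬_; contradiction)
open import Relation.Nullary.Decidable
  using (map′; _×-dec_; _→-dec_; ¬?; decidable-stable; dec-true)
open import Relation.Unary using (Pred; Decidable)

record Graph : Set₁ where
  field
    order       : ℕ
    nonempty    : NonZero order
  V : Set
  V = Fin order
  field
    Adj         : Rel V 0ℓ
    adjacent?   : B.Decidable Adj
    symmetric   : Symmetric Adj
    irreflexive : Irreflexive _≡_ Adj

module _ {n : ℕ} where

  ∀Subset? : {Q : Pred (Subset n) 0ℓ} → Decidable Q → Dec (∀ K → Q K)
  ∀Subset? Q? = map′
    (λ ¬∃ K → decidable-stable (Q? K) (λ ¬q → ¬∃ (K , ¬q)))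
    (λ all (K , ¬q) → ¬q (all K))
    (¬? (anySubset? (¬? ∘ Q?)))

  comprehension : {Q : Pred (Fin n) 0ℓ} → Decidable Q →
                  ∃ λ (p : Subset n) → (∀ {v} → v ∈ p → Q v) × (∀ {v} → Q v → v ∈ p)
  comprehension {Q} Q? = tabulate (does ∘ Q?) , to , from
    where
    lookup-does : ∀ v → Vec.lookup (tabulate (does ∘ Q?)) v ≡ does (Q? v)
    lookup-does = Vec.lookup∘tabulate (does ∘ Q?)

    to : ∀ {v} → v ∈ tabulate (does ∘ Q?) → Q v
    to {v} v∈ with Q? v | trans (sym (lookup-does v)) (Vec.[]=⇒lookup v∈)
    ... | yes q | _  = q
    ... | no _  | ()

    from : ∀ {v} → Q v → v ∈ tabulate (does ∘ Q?)
    from {v} q = Vec.lookup⇒[]= v _ (trans (lookup-does v) (dec-true (Q? v) q))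

  ∀List≤? : ∀ k {Q : Pred (List (Fin n)) 0ℓ} → Decidable Q →
            Dec (∀ vs → length vs ≤ k → Q vs)
  ∀List≤? zero Q? = map′ (λ { q [] _ → q }) (λ all → all [] z≤n) (Q? [])
  ∀List≤? (suc k) Q? = map′
    (λ { (q , _) [] _ → q ; (_ , qs) (v ∷ vs) (s≤s l) → qs v vs l })
    (λ all → all [] z≤n , λ v vs l → all (v ∷ vs) (s≤s l))
    (Q? [] ×-dec Fin.all? (λ v → ∀List≤? k (Q? ∘ (v ∷_))))

  lookup-injective : {vs : List (Fin n)} → Unique vs → ∀ {i j} →
                     lookup vs i ≡ lookup vs j → i ≡ j
  lookup-injective (_  ∷ _) {zero}  {zero}  _  = refl
  lookup-injective (v∉ ∷ _) {zero}  {suc j} eq = contradiction eq (All.lookup v∉ (∈-lookup j))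
  lookup-injective (v∉ ∷ _) {suc i} {zero}  eq = contradiction (sym eq) (All.lookup v∉ (∈-lookup i))
  lookup-injective (_  ∷ u) {suc i} {suc j} eq = cong suc (lookup-injective u eq)

module _ (G : Graph) where
  open Graph G

  -- A path is given by the list of its vertices, so comparing the lengths of
  -- two such lists compares the numbers of edges of the paths.
  IsPath : V → V → List V → Set
  IsPath x y vs = Linked Adj vs × Unique vs × head vs ≡ just x × last vs ≡ just y

  IsShortestPath : V → V → List V → Set
  IsShortestPath x y vs =
    IsPath x y vs × (∀ ws → IsPath x y ws → length vs ≤ length ws)

  Convex : Subset order → Set
  Convex K = ∀ x y → x ∈ K → y ∈ K → ∀ vs → IsShortestPath x y vs → All (_∈ K) vs

  IsSmallestConvexContaining : Subset order → Subset order → Set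
  IsSmallestConvexContaining P H =
    Convex H × P ⊆ H × (∀ K → Convex K → P ⊆ K → H ⊆ K)

  isPath? : ∀ x y → Decidable (IsPath x y)
  isPath? x y vs =
    linked? adjacent? vs
    ×-dec DecUnique.unique? Fin._≟_ vs
    ×-dec Maybe.≡-dec Fin._≟_ (head vs) (just x)
    ×-dec Maybe.≡-dec Fin._≟_ (last vs) (just y)

  -- Paths have at most `order` vertices, so quantifying over them is decidable.
  ∀Path? : ∀ x y {Q : Pred (List V) 0ℓ} → Decidable Q → Dec (∀ vs → IsPath x y vs → Q vs)
  ∀Path? x y Q? = map′
    (λ all vs p → all vs (Fin.injective⇒≤ (lookup-injective (proj₁ (proj₂ p)))) p)
    (λ all vs _ → all vs)
    (∀List≤? order (λ vs → isPath? x y vs →-dec Q? vs))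

  convex? : Decidable Convex
  convex? K =
    Fin.all? λ x → Fin.all? λ y → (x ∈? K) →-dec ((y ∈? K) →-dec
      map′ (λ all vs (p , min) → all vs p min) (λ all vs p min → all vs (p , min))
        (∀Path? x y λ vs →
          ∀Path? x y (λ ws → length vs ≤? length ws) →-dec All.all? (_∈? K) vs))

  smallestConvex : ∀ P → ∃ (IsSmallestConvexContaining P)
  smallestConvex P = H , H-convex , P⊆H , λ K cK P⊆K v∈H → to v∈H K cK P⊆K
    where
    InAll : V → Set
    InAll v = ∀ K → Convex K → P ⊆ K → v ∈ K

    inAll? : Decidable InAll
    inAll? v = ∀Subset? λ K → convex? K →-dec ((P ⊆? K) →-dec (v ∈? K))

    H : Subset order
    H = proj₁ (comprehension inAll?)

    to : ∀ {v} → v ∈ H → InAll v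
    to = proj₁ (proj₂ (comprehension inAll?))

    from : ∀ {v} → InAll v → v ∈ H
    from = proj₂ (proj₂ (comprehension inAll?))

    P⊆H : P ⊆ H
    P⊆H v∈P = from λ _ _ P⊆K → P⊆K v∈P

    H-convex : Convex H
    H-convex x y x∈H y∈H vs sp = All.tabulate λ v∈vs → from λ K cK P⊆K →
      All.lookup (cK x y (to x∈H K cK P⊆K) (to y∈H K cK P⊆K) vs sp) v∈vs

  hull : Subset order → Subset order
  hull P = proj₁ (smallestConvex P)

  Generating : Subset order → Set
  Generating P = hull P ≡ ⊤

  generating? : Decidable Generating
  generating? P = Vec.≡-dec Bool._≟_ (hull P) ⊤

  MinimalGenerating : Subset order → Set
  MinimalGenerating P = Generating P × (∀ Q → Q ⊂ P → ¬ Generating Q)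

pty : ∀ {n} → Subset n → ℕ
pty A = ∣ A ∣ % 2

leastMissing : ∀ (A : List ℕ) → ∃ λ k → k ∉ˡ A × (∀ j → j < k → j ∈ˡ A)
leastMissing A = search (suc (max 0 A)) 0 (λ _ ()) bound∉
  where
  open DecMembership ℕ._≟_ renaming (_∈?_ to _∈ˡ?_)

  bound∉ : suc (max 0 A) + 0 ∉ˡ A
  bound∉ b∈ rewrite ℕ.+-identityʳ (max 0 A) = ℕ.1+n≰n (All.lookup (xs≤max 0 A) b∈)

  search : ∀ d k → (∀ j → j < k → j ∈ˡ A) → d + k ∉ˡ A →
           ∃ λ m → m ∉ˡ A × (∀ j → j < m → j ∈ˡ A)
  search zero    k below k∉ = k , k∉ , below
  search (suc d) k below b∉ with k ∈ˡ? A
  ... | no k∉   = k , k∉ , below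
  ... | yes k∈ = search d (suc k) below′ (λ b∈ → b∉ (subst (_∈ˡ A) (ℕ.+-suc d k) b∈))
    where
    below′ : ∀ j → j < suc k → j ∈ˡ A
    below′ j j<1+k with ℕ.m≤n⇒m<n∨m≡n (ℕ.≤-pred j<1+k)
    ... | inj₁ j<k  = below j j<k
    ... | inj₂ refl = k∈

mex : List ℕ → ℕ
mex A = proj₁ (leastMissing A)

record Game : Set₁ where
  field
    Position    : Set
    options     : Position → List Position
    start       : Position
    wellFounded : WellFounded (λ q p → q ∈ˡ options p)

module _ (Γ : Game) where
  open Game Γ

  nimAcc : ∀ p → Acc (λ q p → q ∈ˡ options p) p → ℕ
  nimAcc p (acc rs) = mex (mapWith∈ (options p) λ {q} q∈ → nimAcc q (rs q∈))

  nimPosition : Position → ℕ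
  nimPosition p = nimAcc p (wellFounded p)

  nim : ℕ
  nim = nimPosition start

module _ (G : Graph) where
  open Graph G

  TER-options : Subset order → List (Subset order)
  TER-options P =
    if does (generating? G (∁ P))
    then map (λ v → P ∪ ⁅ v ⁆) (filter (_∈? ∁ P) (allFin order))
    else []

  TER-option⇒⊃ : ∀ {P Q} → Q ∈ˡ TER-options P → Q ⊃ P
  TER-option⇒⊃ {P} Q∈ with generating? G (∁ P)
  ... | no _ with () ← Q∈
  ... | yes _ with ∈-map⁻ (λ v → P ∪ ⁅ v ⁆) Q∈
  ...   | v , v∈ , refl =
    p⊆p∪q ⁅ v ⁆ , v , q⊆p∪q P ⁅ v ⁆ (x∈⁅x⁆ v) ,
    x∈∁p⇒x∉p (proj₂ (∈-filter⁻ (_∈? ∁ P) {xs = allFin order} v∈))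

  -- Positions not reachable from ∅ are included; they do not affect the value
  -- of the starting position.
  TER : Game
  TER = record
    { Position    = Subset order
    ; options     = TER-options
    ; start       = ⊥
    ; wellFounded = Subrelation.wellFounded TER-option⇒⊃ ⊃-wellFounded
    }

{-# OPTIONS --safe #-}
-- A set generates exactly when it contains L, so a position P is terminal
-- (value 0) as soon as it meets L.  From a position disjoint from L, selecting
-- a vertex of L ends the game, and selecting any other vertex shrinks Lᶜ ∖ P by
-- one.  Hence a position disjoint from L with k vertices left in Lᶜ has value
-- f(k), where f(0) = mex {0} = 1 and f(k+1) = mex {0, f(k)}: the values
-- alternate 1, 2, 1, 2, …
module Submission where

open import Defs
open import Data.Bool using (if_then_else_)
open import Data.Fin using (fromℕ<)
open import Data.Fin.Subset
  using (Subset; ∁; ⊥; _∈_; _∉_; _⊆_; _⊂_; _∪_; _─_; _-_; ⁅_⁆; ∣_∣; inside; outside; Nonempty)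
open import Data.Fin.Subset.Induction using (⊂-wellFounded)
open import Data.Fin.Subset.Properties
open import Data.List using (allFin)
open import Data.List.Membership.Propositional using () renaming (_∈_ to _∈ˡ_; _∉_ to _∉ˡ_)
open import Data.List.Membership.Propositional.Properties
  using (∈-allFin; ∈-filter⁺; ∈-filter⁻; ∈-map⁺; ∈-map⁻)
open import Data.List.Relation.Unary.Any.Properties using (mapWith∈⁺; mapWith∈⁻)
open import Data.Nat using (ℕ; zero; suc; _+_; _<_; _%_; s<s⁻¹; >-nonZero⁻¹)
open import Data.Nat.Properties using (<-cmp; suc-injective)
open import Data.Product using (∃; _×_; _,_; proj₁; proj₂)
open import Data.Sum using ([_,_]′)
open import Data.Vec using (_∷_; here; there)
open import Function using (_∘_; case_of_)
open import Induction.WellFounded using (Acc; acc)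
open import Relation.Binary using (tri<; tri≈; tri>)
open import Relation.Binary.PropositionalEquality using (_≡_; _≢_; refl; sym; trans; cong; subst)
open import Relation.Nullary using (does; yes; no; ¬_; contradiction)
open import Relation.Nullary.Decidable using (_×-dec_; dec-true; dec-false)
open import Relation.Unary using (_≐_; ｛_｝)

n%2≢[1+n]%2 : ∀ n → n % 2 ≢ suc n % 2
n%2≢[1+n]%2 zero          ()
n%2≢[1+n]%2 (suc zero)    ()
n%2≢[1+n]%2 (suc (suc n)) = n%2≢[1+n]%2 n

-- A parity is at most 1, so `i` is 0 and `suc n` is odd, which makes `n` even.
i<[1+n]%2⇒n%2≡i : ∀ n {i} → i < suc n % 2 → n % 2 ≡ i
i<[1+n]%2⇒n%2≡i zero          {zero}  _ = refl
i<[1+n]%2⇒n%2≡i zero          {suc _} i< = contradiction (s<s⁻¹ i<) λ ()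
i<[1+n]%2⇒n%2≡i (suc zero)    ()
i<[1+n]%2⇒n%2≡i (suc (suc n)) i< = i<[1+n]%2⇒n%2≡i n i<

mex-unique : ∀ {A k} → k ∉ˡ A → (∀ j → j < k → j ∈ˡ A) → mex A ≡ k
mex-unique {A} {k} k∉ below with leastMissing A
... | m , m∉ , below′ with <-cmp m k
...   | tri< m<k _ _ = contradiction (below m m<k) m∉
...   | tri≈ _ m≡k _ = m≡k
...   | tri> _ _ k<m = contradiction (below′ k k<m) k∉

module _ (Γ : Game) where
  open Game Γ

  -- The mex recursion has only one solution, so it suffices to guess the nim-values and verify the
  -- two defining properties of mex at each position.
  nimPosition-unique : (f : Position → ℕ) →
    (∀ {p q} → q ∈ˡ options p → f p ≢ f q) →
    (∀ p j → j < f p → ∃ λ q → q ∈ˡ options p × f q ≡ j) →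
    ∀ p → nimPosition Γ p ≡ f p
  nimPosition-unique f avoids attains p = go p (wellFounded p)
    where
    -- Stated for every accessibility proof, since the recursion passes from `acc rs` to `rs q∈` and
    -- not to `wellFounded q`.
    go : ∀ p (a : Acc (λ q p → q ∈ˡ options p) p) → nimAcc Γ p a ≡ f p
    go p (acc rs) = mex-unique
      (λ fp∈ → let q , q∈ , fp≡ = mapWith∈⁻ (options p) _ fp∈
               in avoids q∈ (trans fp≡ (go q (rs q∈))))
      (λ j j< → let q , q∈ , fq≡j = attains p j j<
                in mapWith∈⁺ _ (q , q∈ , trans (sym fq≡j) (sym (go q (rs q∈)))))

x∈p─q⇒x∉q : ∀ {n} (p q : Subset n) {x} → x ∈ p ─ q → x ∉ q
x∈p─q⇒x∉q (_ ∷ p) (outside ∷ q) (there x∈) (there x∈q) = x∈p─q⇒x∉q p q x∈ x∈q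
x∈p─q⇒x∉q (_ ∷ p) (inside  ∷ q) (there x∈) (there x∈q) = x∈p─q⇒x∉q p q x∈ x∈q

x∈p⇒∣p∣≡1+∣p-x∣ : ∀ {n} {p : Subset n} {x} → x ∈ p → ∣ p ∣ ≡ suc ∣ p - x ∣
-- The tail of the singleton of `zero` is `⊥`, so the tail left after the removal is `p ─ ⊥`.
x∈p⇒∣p∣≡1+∣p-x∣ {p = _ ∷ p} here = cong (suc ∘ ∣_∣) (sym (p─⊥≡p p))
x∈p⇒∣p∣≡1+∣p-x∣ {p = outside ∷ _} (there x∈p) = x∈p⇒∣p∣≡1+∣p-x∣ x∈p
x∈p⇒∣p∣≡1+∣p-x∣ {p = inside  ∷ _} (there x∈p) = cong suc (x∈p⇒∣p∣≡1+∣p-x∣ x∈p)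

x∉p∪⁅y⁆ : ∀ {n} {p : Subset n} {x y} → x ∉ p → x ≢ y → x ∉ p ∪ ⁅ y ⁆
x∉p∪⁅y⁆ {p = p} {y = y} x∉p x≢y = [ x∉p , x≢y ∘ x∈⁅y⁆⇒x≡y y ]′ ∘ x∈p∪q⁻ p ⁅ y ⁆

module _ (G : Graph) where
  open Graph G

  hull-convex : ∀ P → Convex G (hull G P)
  hull-convex P = proj₁ (proj₂ (smallestConvex G P))

  ⊆-hull : ∀ P → P ⊆ hull G P
  ⊆-hull P = proj₁ (proj₂ (proj₂ (smallestConvex G P)))

  hull-least : ∀ P {K} → Convex G K → P ⊆ K → hull G P ⊆ K
  hull-least P = proj₂ (proj₂ (proj₂ (smallestConvex G P))) _

  Generating-mono : ∀ {P Q} → P ⊆ Q → Generating G P → Generating G Q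
  Generating-mono {P} {Q} P⊆Q gen = ⊆-antisym ⊆⊤
    (subst (_⊆ hull G Q) gen (hull-least P (hull-convex Q) (⊆-hull Q ∘ P⊆Q)))

  -- The empty set is vacuously convex, hence its own hull, while a graph has a vertex. This is what
  -- forces `L` to be nonempty.
  ¬Generating-⊥ : ¬ Generating G ⊥
  ¬Generating-⊥ gen = ∉⊥ (hull-least ⊥ ⊥-convex ⊥⊆ (subst (v₀ ∈_) (sym gen) ∈⊤))
    where
    v₀ : V
    v₀ = fromℕ< (>-nonZero⁻¹ order ⦃ nonempty ⦄)

    ⊥-convex : Convex G ⊥
    ⊥-convex _ _ x∈⊥ = contradiction x∈⊥ ∉⊥

  -- Pass to strictly smaller generating subsets for as long as one exists; finiteness stops the
  -- descent.
  minimalGenerating-below : ∀ P → Generating G P → ∃ λ Q → Q ⊆ P × MinimalGenerating G Q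
  minimalGenerating-below P = go P (⊂-wellFounded P)
    where
    go : ∀ P → Acc _⊂_ P → Generating G P → ∃ λ Q → Q ⊆ P × MinimalGenerating G Q
    go P (acc rs) gen with anySubset? (λ Q → (Q ⊂? P) ×-dec generating? G Q)
    ... | no ¬smaller = P , ⊆-refl , gen , λ Q Q⊂P genQ → ¬smaller (Q , Q⊂P , genQ)
    ... | yes (Q , Q⊂P , genQ) =
      let R , R⊆Q , min = go Q (rs Q⊂P) genQ
      in R , ⊆-trans R⊆Q (p⊂q⇒p⊆q Q⊂P) , min

  TER-option⁺ : ∀ {P v} → Generating G (∁ P) → v ∉ P → P ∪ ⁅ v ⁆ ∈ˡ TER-options G P
  TER-option⁺ {P} {v} gen v∉P with generating? G (∁ P)
  ... | no ¬gen = contradiction gen ¬gen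
  ... | yes _ = ∈-map⁺ (λ v → P ∪ ⁅ v ⁆) (∈-filter⁺ (_∈? ∁ P) (∈-allFin v) (x∉p⇒x∈∁p v∉P))

  TER-option⁻ : ∀ {P Q} → Q ∈ˡ TER-options G P →
                Generating G (∁ P) × ∃ λ v → v ∉ P × Q ≡ P ∪ ⁅ v ⁆
  TER-option⁻ {P} Q∈ with generating? G (∁ P)
  ... | no _ with () ← Q∈
  ... | yes gen =
    let v , v∈ , Q≡ = ∈-map⁻ (λ v → P ∪ ⁅ v ⁆) Q∈
    in gen , v , x∈∁p⇒x∉p (proj₂ (∈-filter⁻ (_∈? ∁ P) {xs = allFin order} v∈)) , Q≡

  module _ {L : Subset order} (unique : MinimalGenerating G ≐ ｛ L ｝) where

    L-generating : Generating G L
    L-generating = proj₁ (proj₂ unique refl)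

    L-nonempty : Nonempty L
    L-nonempty with nonempty? L
    ... | yes ne = ne
    ... | no empty =
      contradiction (subst (Generating G) (Empty-unique empty) L-generating) ¬Generating-⊥

    -- Some minimal generating set lies below `P`, and by uniqueness it can only be `L`.
    generating⇒L⊆ : ∀ {P} → Generating G P → L ⊆ P
    generating⇒L⊆ {P} gen =
      let Q , Q⊆P , min = minimalGenerating-below P gen
      in subst (_⊆ P) (sym (proj₁ unique min)) Q⊆P

    -- The guessed nim-value. The set `∁ L ─ P` holds the free vertices: those that can still be
    -- selected without ending the game.
    value : Subset order → ℕ
    value P = if does (generating? G (∁ P)) then 1 + pty (∁ L ─ P) else 0

    value-nonterminal : ∀ P → Generating G (∁ P) → value P ≡ 1 + pty (∁ L ─ P)
    value-nonterminal P gen =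
      cong (if_then 1 + pty (∁ L ─ P) else 0) (dec-true (generating? G (∁ P)) gen)

    value-terminal : ∀ P → ¬ Generating G (∁ P) → value P ≡ 0
    value-terminal P ¬gen =
      cong (if_then 1 + pty (∁ L ─ P) else 0) (dec-false (generating? G (∁ P)) ¬gen)

    select∈L⇒terminal : ∀ P {v} → v ∈ L → ¬ Generating G (∁ (P ∪ ⁅ v ⁆))
    select∈L⇒terminal P {v} v∈L gen =
      x∈∁p⇒x∉p (generating⇒L⊆ gen v∈L) (q⊆p∪q P ⁅ v ⁆ (x∈⁅x⁆ v))

    -- `L` avoids `P` because `∁ P` generates, and it avoids `v`; so it survives inside the new
    -- complement.
    select∉L⇒nonterminal : ∀ {P v} → Generating G (∁ P) → v ∉ L →
                           Generating G (∁ (P ∪ ⁅ v ⁆))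
    select∉L⇒nonterminal gen v∉L = Generating-mono
      (λ {x} x∈L → x∉p⇒x∈∁p
        (x∉p∪⁅y⁆ (x∈∁p⇒x∉p (generating⇒L⊆ gen x∈L)) λ { refl → v∉L x∈L }))
      L-generating

    ∣free∣-select : ∀ {P v} → v ∈ ∁ L ─ P → ∣ ∁ L ─ P ∣ ≡ suc ∣ ∁ L ─ (P ∪ ⁅ v ⁆) ∣
    ∣free∣-select {P} {v} v∈ =
      trans (x∈p⇒∣p∣≡1+∣p-x∣ v∈) (cong (suc ∘ ∣_∣) (p─q─r≡p─q∪r (∁ L) P ⁅ v ⁆))

    -- A move in `L` drops a positive value to 0; any other move uses up one free vertex and so
    -- flips the parity.
    value-avoids : ∀ {P Q} → Q ∈ˡ TER-options G P → value P ≢ value Q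
    value-avoids {P} Q∈ eq with TER-option⁻ Q∈
    ... | gen , v , v∉P , refl with v ∈? L
    ...   | yes v∈L with () ← trans (sym (value-nonterminal P gen))
                            (trans eq (value-terminal (P ∪ ⁅ v ⁆) (select∈L⇒terminal P v∈L)))
    ...   | no v∉L = n%2≢[1+n]%2 ∣ ∁ L ─ (P ∪ ⁅ v ⁆) ∣ (sym (suc-injective
      (trans (cong (λ k → suc (k % 2))
               (sym (∣free∣-select (x∈p∧x∉q⇒x∈p─q (x∉p⇒x∈∁p v∉L) v∉P))))
      (trans (sym (value-nonterminal P gen))
      (trans eq (value-nonterminal (P ∪ ⁅ v ⁆) (select∉L⇒nonterminal gen v∉L)))))))

    nonterminal-attains : ∀ P → Generating G (∁ P) → ∀ j → j < 1 + pty (∁ L ─ P) →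
                          ∃ λ Q → Q ∈ˡ TER-options G P × value Q ≡ j
    nonterminal-attains P gen zero _ =
      -- Value 0 is reached by ending the game at once with a vertex of `L`.
      let v , v∈L = L-nonempty
      in P ∪ ⁅ v ⁆
       , TER-option⁺ gen (x∈∁p⇒x∉p (generating⇒L⊆ gen v∈L))
       , value-terminal (P ∪ ⁅ v ⁆) (select∈L⇒terminal P v∈L)
    nonterminal-attains P gen (suc i) j< with nonempty? (∁ L ─ P)
    -- Without free vertices the parity is 0, so no positive `j` lies below the value.
    ... | no empty = contradiction
      (subst (λ k → i < k % 2) (trans (cong ∣_∣ (Empty-unique empty)) (∣⊥∣≡0 order)) (s<s⁻¹ j<))
      λ ()
    ... | yes (v , v∈) =
      -- Here the number of free vertices is odd and `j` is 1; using up any one of them leaves an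
      -- even number, hence value 1.
      P ∪ ⁅ v ⁆
      , TER-option⁺ gen (x∈p─q⇒x∉q (∁ L) P v∈)
      , trans (value-nonterminal (P ∪ ⁅ v ⁆)
                (select∉L⇒nonterminal gen (x∈∁p⇒x∉p (p─q⊆p (∁ L) P v∈))))
              (cong suc (i<[1+n]%2⇒n%2≡i ∣ ∁ L ─ (P ∪ ⁅ v ⁆) ∣
                (subst (λ k → i < k % 2) (∣free∣-select v∈) (s<s⁻¹ j<))))

    value-attains : ∀ P j → j < value P → ∃ λ Q → Q ∈ˡ TER-options G P × value Q ≡ j
    value-attains P j j< = case generating? G (∁ P) of λ where
      (yes gen) → nonterminal-attains P gen j (subst (j <_) (value-nonterminal P gen) j<)
      (no ¬gen) → contradiction (subst (j <_) (value-terminal P ¬gen) j<) λ ()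

proposition4p5 : ∀ (G : Graph) (L : Subset (Graph.order G)) →
    MinimalGenerating G ≐ ｛ L ｝ →
    nim (TER G) ≡ 1 + pty (∁ L)
proposition4p5 G L unique =
  trans (nimPosition-unique (TER G) (value G unique) (value-avoids G unique)
          (value-attains G unique) ⊥)
  -- At the start nothing is selected, so the free vertices are all of `∁ L`.
  (trans (value-nonterminal G unique ⊥ ∁⊥-generating)
         (cong (λ A → 1 + pty A) (p─⊥≡p (∁ L))))
  where
  ∁⊥-generating : Generating G (∁ ⊥)
  ∁⊥-generating = Generating-mono G (λ _ → x∉p⇒x∈∁p ∉⊥) (L-generating G unique)
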